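{- Let $i\ge 3$ and $k\ge 3$ be integers, let $p$ be a nonnegative integer, and put $r=\lfloor (F_i-1)/F_k\rfloor$. If $r\ge p$ and $(r,p)\ne(0,0)$, then $$g_p(F_i,F_{i+2},F_{i+k})=\begin{cases}(F_i-rF_k-1)F_{i+2}+(r+p)F_{i+k}-F_i & \text{if } (F_i-rF_k)F_{i+2}\ge F_{k-2}F_i,\\ (F_k-1)F_{i+2}+(r+p-1)F_{i+k}-F_i & \text{if } (F_i-rF_k)F_{i+2}< F_{k-2}F_i.\end{cases}$$
   Context: Fibonacci numbers: $F_0=0$, $F_1=1$, $F_n=F_{n-1}+F_{n-2}$. For positive integers $a_1,\dots,a_l$ with $\gcd(a_1,\dots,a_l)=1$ and an integer $n$, let $d(n;a_1,\dots,a_l)$ be the number of tuples $(x_1,\dots,x_l)$ of nonnegative integers with $a_1x_1+\dots+a_lx_l=n$. For a nonnegative integer $p$, the $p$-Frobenius number $g_p(a_1,\dots,a_l)$ is the largest integer $n$ with $d(n;a_1,\dots,a_l)\le p$. -}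

module Defs where

open import Data.Integer.Base as ℤ using (ℤ; +_; ∣_∣)
import Data.Integer.Properties as ℤ
open import Data.List.Base
  using (List; []; _∷_; length; filter; upTo; cartesianProductWith)
open import Data.List.Membership.Propositional using (_∈_)
open import Data.List.Membership.Propositional.Properties
  using (∈-cartesianProductWith⁺; ∈-upTo⁺; ∈-filter⁺; ∈-filter⁻)
open import Data.List.Relation.Unary.Any using (here)
import Data.List.Relation.Unary.All as ListAll
open import Data.List.Relation.Unary.AllPairs using ([]; _∷_)
open import Data.List.Relation.Unary.Unique.Propositional using (Unique)
import Data.List.Relation.Unary.Unique.Propositional.Properties as Unique
open import Data.Nat.Base
  using (ℕ; zero; suc; _+_; _*_; _≤_; _<_; z≤n; s≤s; NonZero; >-nonZero)
open import Data.Nat.Properties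
  using (≤-trans; ≤-reflexive; m≤m+n; m≤n+m; m≤n*m; <-≤-trans)
open import Data.Product.Base using (_×_; _,_; proj₂)
open import Data.Vec.Base using (Vec; []; _∷_)
open import Data.Vec.Properties using (∷-injective)
open import Data.Vec.Relation.Unary.All using (All; []; _∷_)
open import Relation.Binary.PropositionalEquality using (_≡_; refl; cong)

F : ℕ → ℕ
F 0             = 0
F 1             = 1
F (suc (suc n)) = F (suc n) + F n

F-suc-pos : ∀ n → 0 < F (suc n)
F-suc-pos zero    = s≤s z≤n
F-suc-pos (suc n) = <-≤-trans (F-suc-pos n) (m≤m+n _ _)

F-nonZero : ∀ {k} → 3 ≤ k → NonZero (F k)
F-nonZero {suc k} _ = >-nonZero (F-suc-pos k)

infix 7 _∙_

_∙_ : ∀ {l} → Vec ℕ l → Vec ℕ l → ℕ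
[]       ∙ []       = 0
(a ∷ as) ∙ (x ∷ xs) = a * x + as ∙ xs

-- All l-tuples with entries at most b.
tuples : ∀ l → ℕ → List (Vec ℕ l)
tuples zero    b = [] ∷ []
tuples (suc l) b = cartesianProductWith _∷_ (upTo (suc b)) (tuples l b)

-- When every aⱼ is positive, a solution of a₁x₁ + … + aₗxₗ = n has all its
-- entries at most n, so the bound on the search loses nothing: see
-- ∈-solutions⁺, ∈-solutions⁻ and solutions-unique below.  There are no
-- solutions for negative n.
solutions : ∀ {l} → ℤ → Vec ℕ l → List (Vec ℕ l)
solutions {l} n as = filter (λ xs → + (as ∙ xs) ℤ.≟ n) (tuples l ∣ n ∣)

d : ∀ {l} → ℤ → Vec ℕ l → ℕ
d n as = length (solutions n as)

-- g is the largest integer n with d(n; a₁, …, aₗ) ≤ p, i.e. g = gₚ(a₁, …, aₗ).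
record IsFrobenius {l} (p : ℕ) (as : Vec ℕ l) (g : ℤ) : Set where
  field
    d≤p     : d g as ≤ p
    largest : ∀ n → d n as ≤ p → n ℤ.≤ g

∈-tuples⁺ : ∀ {l} {as : Vec ℕ l} → All NonZero as →
            ∀ xs {b} → as ∙ xs ≤ b → xs ∈ tuples l b
∈-tuples⁺ []                           []       _   = here refl
∈-tuples⁺ {as = a ∷ as} (a≢0 ∷ as≢0) (x ∷ xs) s≤b =
  ∈-cartesianProductWith⁺ _∷_
    (∈-upTo⁺ (s≤s (≤-trans (m≤n*m x a {{a≢0}}) (≤-trans (m≤m+n _ _) s≤b))))
    (∈-tuples⁺ as≢0 xs (≤-trans (m≤n+m _ _) s≤b))

tuples-unique : ∀ l b → Unique (tuples l b)
tuples-unique zero    b = ListAll.[] ∷ []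
tuples-unique (suc l) b =
  Unique.cartesianProductWith⁺ _∷_ ∷-injective
    (Unique.upTo⁺ (suc b)) (tuples-unique l b)

∈-solutions⁺ : ∀ {l n} {as : Vec ℕ l} → All NonZero as →
               ∀ xs → + (as ∙ xs) ≡ n → xs ∈ solutions n as
∈-solutions⁺ as≢0 xs eq =
  ∈-filter⁺ _ (∈-tuples⁺ as≢0 xs (≤-reflexive (cong ∣_∣ eq))) eq

∈-solutions⁻ : ∀ {l} n (as : Vec ℕ l) {xs} →
               xs ∈ solutions n as → + (as ∙ xs) ≡ n
∈-solutions⁻ {l} n as xs∈ =
  proj₂ (∈-filter⁻ (λ xs → + (as ∙ xs) ℤ.≟ n) {xs = tuples l ∣ n ∣} xs∈)

solutions-unique : ∀ {l} n (as : Vec ℕ l) → Unique (solutions n as)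
solutions-unique {l} n as = Unique.filter⁺ _ (tuples-unique l ∣ n ∣)

{-# OPTIONS --safe #-}

-- Write a = F_i, b = F_{i+2}, c = F_{i+k}, m = F_k, e = F_{k-2}.  Then c + e a = m b, so b y + c z
-- lies in the class of T b modulo a, where T = y + m z.  Within one T, replacing (y, z) by
-- (y + m, z − 1) raises the sum by e a ≤ c, so each class mod a gets its smallest sums from
-- the largest z.  With a = q + 1 + m r, every class has p + 1 sums (from T = s and, once these
-- are exhausted, from T = s + a, where s < a) that are at most the larger of b q + c (r + p) and
-- b (m − 1) + c (r + p − 1), and gₚ is that maximum minus a.  Which one is larger is decided
-- by comparing (q + 1) b with e a.
module Submission where

open import Defs
open import Data.Fin.Base as Fin using (Fin; toℕ; fromℕ<)
open import Data.Fin.Properties using (injective⇒≤; toℕ-injective; toℕ<n; toℕ-fromℕ<)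
import Data.Integer.Base as ℤ
import Data.Integer.Properties as ℤ
import Data.Integer.Tactic.RingSolver as ℤ
open import Data.List.Base using (List; lookup)
open import Data.List.Membership.Propositional using (_∈_)
open import Data.List.Membership.Propositional.Properties using (∈-lookup)
import Data.List.Relation.Unary.All as ListAll
open import Data.List.Relation.Unary.AllPairs using (_∷_)
open import Data.List.Relation.Unary.Any using (index)
open import Data.List.Relation.Unary.Any.Properties using (lookup-index)
open import Data.List.Relation.Unary.Unique.Propositional using (Unique)
open import Data.Nat.Base as ℕ using (ℕ; suc; pred; NonZero; _≤_; _∸_)
open import Data.Nat.Coprimality as Coprime using (Coprime; coprime-Bézout; coprime-divisor)
open import Data.Nat.DivMod using (_/_; _%_; m≡m%n+[m/n]*n; m%n<n)
open import Data.Nat.Divisibility using (_∣_; divides; ∣m+n∣m⇒∣n; n∣m*n)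
open import Data.Nat.GCD using (module Bézout)
open import Data.Nat.Properties
open import Data.Nat.Tactic.RingSolver using (solve-∀)
open import Data.Product.Base using (_×_; _,_; ∃; proj₁; proj₂)
open import Data.Sum.Base using (_⊎_; inj₁; inj₂)
open import Data.Vec.Base using (Vec; _∷_; [])
open import Data.Vec.Relation.Unary.All using (All; []; _∷_)
open import Function.Definitions using (Injective)
open import Relation.Binary.PropositionalEquality
  using (_≡_; _≢_; refl; sym; trans; cong; cong₂; subst; subst₂; module ≡-Reasoning)
open import Relation.Nullary using (contradiction)

-- Bounding `d` from both sides by injections.

Unique-lookup-injective : ∀ {A : Set} {xs : List A} → Unique xs → Injective _≡_ _≡_ (lookup xs)
Unique-lookup-injective (_ ∷ _)    {Fin.zero}  {Fin.zero}  _  = refl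
Unique-lookup-injective (x∉ ∷ _)   {Fin.zero}  {Fin.suc j} eq = contradiction eq (ListAll.lookup x∉ (∈-lookup j))
Unique-lookup-injective (x∉ ∷ _)   {Fin.suc i} {Fin.zero}  eq = contradiction (sym eq) (ListAll.lookup x∉ (∈-lookup i))
Unique-lookup-injective (_ ∷ uniq) {Fin.suc i} {Fin.suc j} eq = cong Fin.suc (Unique-lookup-injective uniq eq)

-- Says that at most `p` elements satisfy `P`. Keys are plain naturals defined on all of `A`, so the
-- bound and the injectivity can be proved separately, each only where `P` holds.
record CountBelow {A : Set} (p : ℕ) (P : A → Set) : Set where
  field
    key       : A → ℕ
    key<      : ∀ {x} → P x → key x ℕ.< p
    injective : ∀ {x y} → P x → P y → key x ≡ key y → x ≡ y

record CountAbove {A : Set} (p : ℕ) (P : A → Set) : Set where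
  field
    element   : Fin p → A
    holds     : ∀ i → P (element i)
    injective : Injective _≡_ _≡_ element

module _ {l p : ℕ} {as : Vec ℕ l} {n : ℤ.ℤ} where

  -- The list of solutions has no duplicates, so its positions inject into `Fin p` through the key.
  d≤ : CountBelow p (λ xs → ℤ.+ (as ∙ xs) ≡ n) → d n as ≤ p
  d≤ C = injective⇒≤ {f = code} (λ {i} {j} eq → Unique-lookup-injective (solutions-unique n as)
    (injective (solves i) (solves j)
      (trans (sym (toℕ-fromℕ< _)) (trans (cong toℕ eq) (toℕ-fromℕ< _)))))
    where
    open CountBelow C
    solves : ∀ i → ℤ.+ (as ∙ lookup (solutions n as) i) ≡ n
    solves i = ∈-solutions⁻ n as (∈-lookup i)
    code : Fin (d n as) → Fin p
    code i = fromℕ< (key< (solves i))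

  ≤d : All NonZero as → CountAbove p (λ xs → ℤ.+ (as ∙ xs) ≡ n) → p ≤ d n as
  ≤d as≢0 C = injective⇒≤ {f = λ i → index (found i)} (λ {i} {j} eq →
    injective (trans (lookup-index (found i))
      (trans (cong (lookup (solutions n as)) eq) (sym (lookup-index (found j))))))
    where
    open CountAbove C
    found : ∀ i → element i ∈ solutions n as
    found i = ∈-solutions⁺ as≢0 (element i) (holds i)

-- Moving the summand `a` from the Frobenius number to the linear form.

+-transfer : ∀ {s a N} → s ℕ.+ a ≡ N → ℤ.+ s ≡ ℤ.+ N ℤ.- ℤ.+ a
+-transfer {s} {a} refl = arrange (ℤ.+ s) (ℤ.+ a)
  where
  arrange : ∀ s a → s ≡ s ℤ.+ a ℤ.- a
  arrange = ℤ.solve-∀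

+-transfer⁻¹ : ∀ {s a N} → ℤ.+ s ≡ ℤ.+ N ℤ.- ℤ.+ a → s ℕ.+ a ≡ N
+-transfer⁻¹ {s} {a} {N} eq = ℤ.+-injective (trans (cong (ℤ._+ ℤ.+ a) eq) (arrange (ℤ.+ N) (ℤ.+ a)))
  where
  arrange : ∀ n a → n ℤ.- a ℤ.+ a ≡ n
  arrange = ℤ.solve-∀

module _ {l a p G : ℕ} {as : Vec ℕ l} (as≢0 : All NonZero as)
  (few : CountBelow p (λ xs → as ∙ xs ℕ.+ a ≡ G))
  (many : ∀ n → G ℕ.< n → CountAbove (suc p) (λ xs → as ∙ xs ℕ.+ a ≡ n)) where

  -- Counting solutions of `as ∙ xs + a ≡ n` instead of `as ∙ xs ≡ n - a` keeps both counts in the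
  -- naturals, although `G - a` and the competing integers may be negative.
  isFrobenius-shifted : IsFrobenius p as (ℤ.+ G ℤ.- ℤ.+ a)
  isFrobenius-shifted = record
    { d≤p     = d≤ {as = as} record
      { key       = key
      ; key<      = λ eq → key< (+-transfer⁻¹ eq)
      ; injective = λ eq eq′ → injective (+-transfer⁻¹ eq) (+-transfer⁻¹ eq′)
      }
    ; largest = λ n d≤p → ℤ.≮⇒≥ (λ g<n → ≤⇒≯ d≤p (exceeds n g<n))
    }
    where
    open CountBelow few
    exceeds : ∀ n → ℤ.+ G ℤ.- ℤ.+ a ℤ.< n → p ℕ.< d n as
    exceeds n g<n = lemma (n ℤ.+ ℤ.+ a) refl
      where
      arrange : ∀ n a → n ℤ.- a ℤ.+ a ≡ n
      arrange = ℤ.solve-∀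
      arrange′ : ∀ n a → n ℤ.+ a ℤ.- a ≡ n
      arrange′ = ℤ.solve-∀
      G<n+a : ℤ.+ G ℤ.< n ℤ.+ ℤ.+ a
      G<n+a = subst (ℤ._< n ℤ.+ ℤ.+ a) (arrange (ℤ.+ G) (ℤ.+ a)) (ℤ.+-monoˡ-< (ℤ.+ a) g<n)
      lemma : ∀ N → n ℤ.+ ℤ.+ a ≡ N → p ℕ.< d n as
      -- Impossible, since `n + a` exceeds the natural number `G`.
      lemma ℤ.-[1+ N ] eq with () ← subst (ℤ.+ G ℤ.<_) eq G<n+a
      lemma (ℤ.+ N)    eq = ≤d {as = as} as≢0 record
        { element   = C.element
        ; holds     = λ i → trans (+-transfer (C.holds i)) n≡
        ; injective = C.injective
        }
        where
        module C = CountAbove (many N (ℤ.drop‿+<+ (subst (ℤ.+ G ℤ.<_) eq G<n+a)))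
        n≡ : ℤ.+ N ℤ.- ℤ.+ a ≡ n
        n≡ = trans (cong (ℤ._- ℤ.+ a) (sym eq)) (arrange′ n (ℤ.+ a))

-- Congruences modulo `a`, written with multiples of `a` added on both sides.

module Arithmetic where

  open import Data.Nat.Base using (_+_; _*_; _<_)

  module _ {a b : ℕ} (a⊥b : Coprime a b) where

    -- Cancelling `u * b` leaves `a` dividing `b * (v - u)`, and coprimality removes the factor `b`.
    congruent⇒offset : ∀ {u v k l} → u * b + k * a ≡ v * b + l * a →
                       u ≤ v → ∃ λ t → v ≡ u + t * a
    congruent⇒offset {u} {v} {k} {l} eq u≤v with m≤n⇒∃[o]m+o≡n u≤v
    ... | δ , refl with coprime-divisor a⊥b a∣bδ
      where
      cancelled : l * a + b * δ ≡ k * a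
      cancelled = +-cancelˡ-≡ (u * b) _ _ (trans (arrange u b l a δ) (sym eq))
        where
        arrange : ∀ u b l a δ → u * b + (l * a + b * δ) ≡ (u + δ) * b + l * a
        arrange = solve-∀
      a∣bδ : a ∣ b * δ
      a∣bδ = ∣m+n∣m⇒∣n (subst (a ∣_) (sym cancelled) (n∣m*n k)) (n∣m*n l)
    ... | divides t refl = t , refl

    inverse : .{{NonZero a}} →
              ∃ λ t → ∃ λ u → ∃ λ v → 1 + u * a ≡ t * b + v * a
    inverse with coprime-Bézout a⊥b
    ... | Bézout.Identity.-+ x y eq = y , x , 0 , trans eq (sym (+-identityʳ _))
    -- Here `- y` inverts `b` modulo `a`; its nonnegative representative is `y * (a - 1)`.
    ... | Bézout.Identity.+- x y eq = y * pred a , y * b , x , (begin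
      1 + y * b * a                              ≡⟨ cong (λ n → 1 + y * b * n) (suc-pred a) ⟨
      1 + y * b * (1 + pred a)               ≡⟨ arrange y b (pred a) ⟩
      y * pred a * b + (1 + y * b)         ≡⟨ cong (y * pred a * b +_) eq ⟩
      y * pred a * b + x * a                 ∎)
      where
      open ≡-Reasoning
      arrange : ∀ y b a′ → 1 + y * b * (1 + a′) ≡ y * a′ * b + (1 + y * b)
      arrange = solve-∀

    residue : .{{_ : NonZero a}} → ∀ n →
              ∃ λ s → s < a × ∃ λ k → ∃ λ l → n + k * a ≡ s * b + l * a
    residue n with inverse
    ... | t , u , v , eq = s , m%n<n (n * t) a , n * u , w * b + n * v , (begin
      n + n * u * a                          ≡⟨ arrange₁ n u a ⟩
      n * (1 + u * a)                        ≡⟨ cong (n *_) eq ⟩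
      n * (t * b + v * a)                  ≡⟨ arrange₂ n t b v a ⟩
      n * t * b + n * v * a              ≡⟨ cong (λ h → h * b + n * v * a) (m≡m%n+[m/n]*n (n * t) a) ⟩
      (s + w * a) * b + n * v * a      ≡⟨ arrange₃ s w a b (n * v) ⟩
      s * b + (w * b + n * v) * a      ∎)
      where
      open ≡-Reasoning
      s = (n * t) % a
      w = (n * t) / a
      arrange₁ : ∀ n u a → n + n * u * a ≡ n * (1 + u * a)
      arrange₁ = solve-∀
      arrange₂ : ∀ n t b v a → n * (t * b + v * a) ≡ n * t * b + n * v * a
      arrange₂ = solve-∀
      arrange₃ : ∀ s w a b h → (s + w * a) * b + h * a ≡ s * b + (w * b + h) * a
      arrange₃ = solve-∀

  -- A number strictly above `v` in its class modulo `a` is at least `v + a`. The compulsory extra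
  -- `a` is exactly the shift in the counted equation.
  offset-positive : ∀ {a v n k l} → v < n → n + k * a ≡ v + l * a →
                    ∃ λ x → n ≡ a * x + v + a
  offset-positive {a} {v} {n} {k} {l} v<n eq
    with congruent⇒offset (Coprime.sym (Coprime.1-coprimeTo a)) {v} {n} {l} {k}
           (trans (cong (_+ l * a) (*-identityʳ v))
             (trans (sym eq) (sym (cong (_+ k * a) (*-identityʳ n)))))
           (<⇒≤ v<n)
  ... | 0       , refl = contradiction (sym (+-identityʳ v)) (<⇒≢ v<n)
  ... | suc x , refl = x , arrange v x a
    where
    arrange : ∀ v x a → v + (a + x * a) ≡ a * x + v + a
    arrange = solve-∀

  -- The values of `b y + c z` and their classes modulo `a`.

  module Triple {a b c m e : ℕ} .{{_ : NonZero a}} .{{_ : NonZero m}}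
    (a⊥b : Coprime a b) (relation : c + e * a ≡ m * b)
    (ea≤c : e * a ≤ c) (m≤a : m ≤ a) where

    value : ℕ → ℕ → ℕ
    value y z = b * y + c * z

    value-mod : ∀ y z → value y z + z * e * a ≡ (y + m * z) * b
    value-mod y z = begin
      value y z + z * e * a      ≡⟨ arrange₁ a b c e y z ⟩
      b * y + z * (c + e * a)    ≡⟨ cong (λ h → b * y + z * h) relation ⟩
      b * y + z * (m * b)        ≡⟨ arrange₂ b m y z ⟩
      (y + m * z) * b            ∎
      where
      open ≡-Reasoning
      arrange₁ : ∀ a b c e y z → b * y + c * z + z * e * a ≡ b * y + z * (c + e * a)
      arrange₁ = solve-∀
      arrange₂ : ∀ b m y z → b * y + z * (m * b) ≡ (y + m * z) * b
      arrange₂ = solve-∀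

    -- For fixed `T = y + m z` this shows the value growing with `y`, and it lets values from
    -- different `T` be compared.
    *-value : ∀ y z → m * value y z ≡ (y + m * z) * c + e * a * y
    *-value y z = begin
      m * value y z                    ≡⟨ arrange₁ b c m y z ⟩
      m * b * y + m * z * c            ≡⟨ cong (λ h → h * y + m * z * c) relation ⟨
      (c + e * a) * y + m * z * c      ≡⟨ arrange₂ a c e m y z ⟩
      (y + m * z) * c + e * a * y      ∎
      where
      open ≡-Reasoning
      arrange₁ : ∀ b c m y z → m * (b * y + c * z) ≡ m * b * y + m * z * c
      arrange₁ = solve-∀
      arrange₂ : ∀ a c e m y z → (c + e * a) * y + m * z * c ≡ (y + m * z) * c + e * a * y
      arrange₂ = solve-∀

    value-mono : ∀ {y y′ z z′} → y ≤ y′ → z ≤ z′ → value y z ≤ value y′ z′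
    value-mono y≤y′ z≤z′ = +-mono-≤ (*-monoʳ-≤ b y≤y′) (*-monoʳ-≤ c z≤z′)

    -- Trading one `z` for `m` of `y` replaces `c` by `m * b = c + e * a`, which is at most `2 c`;
    -- hence `m * j` extra `y` cost no more than `2 j` extra `z`.
    value-slide : ∀ y j w → value (y + m * j) w ≤ value y (j + w + j)
    value-slide y j w = begin
      b * (y + m * j) + c * w            ≡⟨ arrange₁ b c m y j w ⟩
      b * y + c * w + m * b * j          ≡⟨ cong (λ h → b * y + c * w + h * j) relation ⟨
      b * y + c * w + (c + e * a) * j    ≤⟨ +-monoʳ-≤ (b * y + c * w) (*-monoˡ-≤ j (+-monoʳ-≤ c ea≤c)) ⟩
      b * y + c * w + (c + c) * j        ≡⟨ arrange₂ b c y j w ⟩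
      b * y + c * (j + w + j)            ∎
      where
      open ≤-Reasoning
      arrange₁ : ∀ b c m y j w → b * (y + m * j) + c * w ≡ b * y + c * w + m * b * j
      arrange₁ = solve-∀
      arrange₂ : ∀ b c y j w → b * y + c * w + (c + c) * j ≡ b * y + c * (j + w + j)
      arrange₂ = solve-∀

    -- After scaling by `m`, `*-value` applies to both sides. For `t = 0`, `y₀ < m` makes `y₀` the
    -- least possible `y`. For `t > 0`, the gain of at least `a * c` covers `e * a * y₀`, because
    -- `e * a ≤ c` and `y₀ < m ≤ a`.
    value-minimal : ∀ {y₀ z₀ y z} t → y₀ < m → y + m * z ≡ y₀ + m * z₀ + t * a →
                    value y₀ z₀ ≤ value y z
    value-minimal {y₀} {z₀} {y} {z} t y₀<m eq = *-cancelˡ-≤ m (begin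
      m * value y₀ z₀                              ≡⟨ *-value y₀ z₀ ⟩
      (y₀ + m * z₀) * c + e * a * y₀               ≤⟨ +-monoʳ-≤ ((y₀ + m * z₀) * c) (defect t eq) ⟩
      (y₀ + m * z₀) * c + (t * a * c + e * a * y)  ≡⟨ arrange (y₀ + m * z₀) c (t * a) (e * a * y) ⟩
      (y₀ + m * z₀ + t * a) * c + e * a * y        ≡⟨ cong (λ T → T * c + e * a * y) eq ⟨
      (y + m * z) * c + e * a * y                  ≡⟨ *-value y z ⟨
      m * value y z                                ∎)
      where
      open ≤-Reasoning
      arrange : ∀ T c u v → T * c + (u * c + v) ≡ (T + u) * c + v
      arrange = solve-∀
      defect : ∀ t → y + m * z ≡ y₀ + m * z₀ + t * a → e * a * y₀ ≤ t * a * c + e * a * y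
      defect 0 eq = *-monoʳ-≤ (e * a) y₀≤y
        where
        T≡T₀ : y + m * z ≡ y₀ + m * z₀
        T≡T₀ = trans eq (+-identityʳ _)
        z<1+z₀ : z < suc z₀
        z<1+z₀ = *-cancelˡ-< m z (suc z₀) (begin-strict
          m * z          ≤⟨ m≤n+m (m * z) y ⟩
          y + m * z      ≡⟨ T≡T₀ ⟩
          y₀ + m * z₀    <⟨ +-monoˡ-< (m * z₀) y₀<m ⟩
          m + m * z₀     ≡⟨ *-suc m z₀ ⟨
          m * suc z₀     ∎)
        y₀≤y : y₀ ≤ y
        y₀≤y = +-cancelʳ-≤ (m * z₀) y₀ y (begin
          y₀ + m * z₀    ≡⟨ T≡T₀ ⟨
          y + m * z      ≤⟨ +-monoʳ-≤ y (*-monoʳ-≤ m (ℕ.s≤s⁻¹ z<1+z₀)) ⟩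
          y + m * z₀     ∎)
      defect (suc t) eq = begin
        e * a * y₀                     ≤⟨ *-mono-≤ ea≤c (<⇒≤ (<-≤-trans y₀<m m≤a)) ⟩
        c * a                          ≡⟨ *-comm c a ⟩
        a * c                          ≤⟨ *-monoˡ-≤ c (m≤m+n a (t * a)) ⟩
        (a + t * a) * c                ≤⟨ m≤m+n _ _ ⟩
        (a + t * a) * c + e * a * y    ∎

    -- The two values agree modulo `a`, so `T` and `T₀` differ by a multiple of `a`. Minimality of
    -- `value y₀ z₀` rules out `T ≥ T₀`, and `T₀ < a + m * p ≤ 2 a` rules out a gap of `2 a` or
    -- more.
    predecessor : ∀ {p y₀ z₀} → m * p ≤ a → y₀ < m → y₀ + m * z₀ < a + m * p →
                  ∀ {x y z} → a * x + value y z + a ≡ value y₀ z₀ →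
                  y + m * z + a ≡ y₀ + m * z₀
    predecessor {p} {y₀} {z₀} mp≤a y₀<m T₀<a+mp {x} {y} {z} eq =
      by-order (≤-total (y + m * z) (y₀ + m * z₀))
      where
      T T₀ : ℕ
      T  = y + m * z
      T₀ = y₀ + m * z₀

      balance : T * b + (x + 1 + z₀ * e) * a ≡ T₀ * b + z * e * a
      balance = begin
        T * b + (x + 1 + z₀ * e) * a                       ≡⟨ cong (_+ (x + 1 + z₀ * e) * a) (value-mod y z) ⟨
        value y z + z * e * a + (x + 1 + z₀ * e) * a       ≡⟨ arrange a x (value y z) (z * e * a) (z₀ * e) ⟩
        a * x + value y z + a + z₀ * e * a + z * e * a     ≡⟨ cong (λ h → h + z₀ * e * a + z * e * a) eq ⟩
        value y₀ z₀ + z₀ * e * a + z * e * a               ≡⟨ cong (_+ z * e * a) (value-mod y₀ z₀) ⟩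
        T₀ * b + z * e * a                                 ∎
        where
        open ≡-Reasoning
        arrange : ∀ a x v h k → v + h + (x + 1 + k) * a ≡ a * x + v + a + k * a + h
        arrange = solve-∀

      not-above : ∀ {t} → T ≢ T₀ + t * a
      not-above {t} T≡ = contradiction (begin-strict
        value y z              <⟨ m<m+n (value y z) (ℕ.>-nonZero⁻¹ a) ⟩
        value y z + a          ≤⟨ +-monoˡ-≤ a (m≤n+m _ (a * x)) ⟩
        a * x + value y z + a  ≡⟨ eq ⟩
        value y₀ z₀            ∎)
        (≤⇒≯ (value-minimal {z₀ = z₀} {y} {z} t y₀<m T≡))
        where open ≤-Reasoning

      by-order : T ≤ T₀ ⊎ T₀ ≤ T → T + a ≡ T₀
      by-order (inj₂ T₀≤T) with t , T≡ ← congruent⇒offset a⊥b {k = z * e} {x + 1 + z₀ * e} (sym balance) T₀≤T =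
        contradiction T≡ (not-above {t})
      by-order (inj₁ T≤T₀) with congruent⇒offset a⊥b {k = x + 1 + z₀ * e} {z * e} balance T≤T₀
      ... | 0           , T₀≡ = contradiction (sym (trans (+-identityʳ _) (trans T₀≡ (+-identityʳ _)))) (not-above {0})
      ... | 1           , T₀≡ = sym (trans T₀≡ (cong (T +_) (*-identityˡ a)))
      ... | suc (suc t) , T₀≡ = contradiction T₀<a+mp (≤⇒≯ (begin
        a + m * p              ≤⟨ +-monoʳ-≤ a mp≤a ⟩
        a + a                  ≤⟨ +-monoʳ-≤ a (m≤m+n a (t * a)) ⟩
        a + (a + t * a)        ≤⟨ m≤n+m _ T ⟩
        T + (a + (a + t * a))  ≡⟨ T₀≡ ⟨
        T₀                     ∎))
        where open ≤-Reasoning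

    -- A solution for `n - a` inside one fixed `T`. The rank `j` is the distance of `z` below `Z`,
    -- which is always chosen as the quotient of `T` by `m`, the largest possible `z`.
    record Representation (n T Z j : ℕ) : Set where
      constructor representation
      field
        {x y z} : ℕ
        sum     : a * x + value y z + a ≡ n
        class   : y + m * z ≡ T
        rank    : j + z ≡ Z

      tuple : Vec ℕ 3
      tuple = x ∷ y ∷ z ∷ []

    open Representation

    same-tuple⇒same-class : ∀ {n T T′ Z Z′ j j′} (R : Representation n T Z j) (R′ : Representation n T′ Z′ j′) →
                            tuple R ≡ tuple R′ → T ≡ T′
    same-tuple⇒same-class R R′ refl = trans (sym (class R)) (class R′)

    same-tuple⇒same-rank : ∀ {n T T′ Z j j′} (R : Representation n T Z j) (R′ : Representation n T′ Z j′) →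
                           tuple R ≡ tuple R′ → j ≡ j′
    same-tuple⇒same-rank R R′ refl = +-cancelʳ-≡ _ _ _ (trans (rank R) (sym (rank R′)))

    -- Finding `p + 1` solutions for every `n` above `G`.

    module _ {q r p G : ℕ}
      (a≡ : a ≡ suc q + m * suc r) (q<m : q < m) (p≤r : p ≤ suc r)
      (G₁≤G : value q (suc r + p) ≤ G) (G₂≤G : value (pred m) (r + p) ≤ G) where

      -- The admissible pairs lie below one of two corners: `(q, suc r + p)` in the top row,
      -- `(m - 1, r + p)` in the rows beneath it.
      value-bound : ∀ {y z} → y < m → z ≤ suc r + p → (z ≡ suc r + p → y ≤ q) → value y z ≤ G
      value-bound {y} {z} y<m z≤ y≤q with m≤n⇒m<n∨m≡n z≤
      ... | inj₁ z< = ≤-trans (value-mono (<⇒≤pred y<m) (ℕ.s≤s⁻¹ z<)) G₂≤G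
      ... | inj₂ z≡ = ≤-trans (value-mono (y≤q z≡) z≤) G₁≤G

      module _ {n s k l : ℕ} (G<n : G < n) (n≡ : n + k * a ≡ s * b + l * a) where

        -- Rank `j` uses `w = Z - j` for `z` and `y + m * j` for `y`. By `value-slide` its value is
        -- at most `value y (Z + j)`, hence at most `G` and less than `n`; being congruent to `n`,
        -- it leaves a nonnegative `x` by `offset-positive`.
        represent : ∀ t {y Z j} → y < m → y + m * Z ≡ s + t * a → j ≤ Z →
                    Z + j ≤ suc r + p → (Z + j ≡ suc r + p → y ≤ q) →
                    Representation n (s + t * a) Z j
        represent t {y} {Z} {j} y<m T≡ j≤Z Z+j≤ y≤q with m≤n⇒∃[o]m+o≡n j≤Z
        ... | w , refl with offset-positive {k = k + t * b} {l + w * e}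
                              (≤-<-trans (≤-trans (value-slide y j w) (value-bound y<m Z+j≤ y≤q)) G<n) offset
          where
          open ≡-Reasoning
          arrange₁ : ∀ n k t a b → n + (k + t * b) * a ≡ n + k * a + t * a * b
          arrange₁ = solve-∀
          arrange₂ : ∀ s b h u → s * b + h + u * b ≡ (s + u) * b + h
          arrange₂ = solve-∀
          arrange₃ : ∀ y m j w b h → (y + m * (j + w)) * b + h ≡ (y + m * j + m * w) * b + h
          arrange₃ = solve-∀
          arrange₄ : ∀ v u a l → v + u * a + l * a ≡ v + (l + u) * a
          arrange₄ = solve-∀
          offset : n + (k + t * b) * a ≡ value (y + m * j) w + (l + w * e) * a
          offset = begin
            n + (k + t * b) * a                              ≡⟨ arrange₁ n k t a b ⟩
            n + k * a + t * a * b                            ≡⟨ cong (_+ t * a * b) n≡ ⟩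
            s * b + l * a + t * a * b                        ≡⟨ arrange₂ s b (l * a) (t * a) ⟩
            (s + t * a) * b + l * a                          ≡⟨ cong (λ T → T * b + l * a) T≡ ⟨
            (y + m * (j + w)) * b + l * a                    ≡⟨ arrange₃ y m j w b (l * a) ⟩
            (y + m * j + m * w) * b + l * a                  ≡⟨ cong (_+ l * a) (value-mod (y + m * j) w) ⟨
            value (y + m * j) w + w * e * a + l * a          ≡⟨ arrange₄ (value (y + m * j) w) (w * e) a l ⟩
            value (y + m * j) w + (l + w * e) * a            ∎
        ...   | x , n≡x = representation (sym n≡x) (trans (arrange y m j w) T≡) refl
          where
          arrange : ∀ y m j w → y + m * j + m * w ≡ y + m * (j + w)
          arrange = solve-∀

        module _ {y₀ z₀ : ℕ} (y₀<m : y₀ < m) (s≡ : s ≡ y₀ + m * z₀) (s<a : s < a) where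

          z₀≤r : z₀ ≤ suc r
          z₀≤r = ℕ.s≤s⁻¹ (*-cancelˡ-< m z₀ (2 + r) (begin-strict
            m * z₀              ≤⟨ m≤n+m (m * z₀) y₀ ⟩
            y₀ + m * z₀         ≡⟨ s≡ ⟨
            s                   <⟨ s<a ⟩
            a                   ≡⟨ a≡ ⟩
            suc q + m * suc r   ≤⟨ +-monoˡ-≤ (m * suc r) q<m ⟩
            m + m * suc r       ≡⟨ *-suc m (suc r) ⟨
            m * (2 + r)         ∎))
            where open ≤-Reasoning

          y₀≤q : z₀ ≡ suc r → y₀ ≤ q
          y₀≤q refl = ℕ.s≤s⁻¹ (+-cancelʳ-< (m * suc r) y₀ (suc q) (subst₂ _<_ s≡ a≡ s<a))

          s<s+a : s < s + 1 * a
          s<s+a = m<m+n s (subst (0 <_) (sym (*-identityˡ a)) (ℕ.>-nonZero⁻¹ a))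

          -- The top row `z₀ + j = suc r + p` is reached only when `z₀ = suc r`, and then `s < a`
          -- forces `y₀ ≤ q`.
          lower-class : ∀ {j} → j ≤ z₀ → j ≤ p → Representation n s z₀ j
          lower-class {j} j≤z₀ j≤p =
            subst (λ T → Representation n T z₀ j) (+-identityʳ s)
              (represent 0 y₀<m (trans (sym s≡) (sym (+-identityʳ s))) j≤z₀ (+-mono-≤ z₀≤r j≤p)
                (λ z₀+j≡ → y₀≤q (≤-antisym z₀≤r (+-cancelʳ-≤ p (suc r) z₀
                  (≤-trans (≤-reflexive (sym z₀+j≡)) (+-monoʳ-≤ z₀ j≤p))))))

          -- `Z` is the quotient of `s + a` by `m`, found by adding `(y₀, z₀)` and `(suc q, suc r)`
          -- with a possible carry. The bound `p ≤ suc r` gives `j ≤ Z` for all ranks needed.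
          upper-class : ∃ λ Z → ∀ {j} → suc z₀ + j ≤ p → Representation n (s + 1 * a) Z j
          upper-class with <-≤-connex (y₀ + suc q) m
          -- No carry: `Z + j` stays strictly below the top row, so nothing is asked of the
          -- remainder.
          ... | inj₁ y<m = z₀ + suc r , λ {j} j<p →
            let sum< : z₀ + suc r + j < suc r + p
                sum< = subst (_< suc r + p) (arrange z₀ r j) (+-monoʳ-< (suc r) j<p)
            in represent 1 y<m (begin
              y₀ + suc q + m * (z₀ + suc r)          ≡⟨ arrange′ y₀ (suc q) m z₀ (suc r) ⟩
              y₀ + m * z₀ + 1 * (suc q + m * suc r)  ≡⟨ cong₂ (λ u v → u + 1 * v) s≡ a≡ ⟨
              s + 1 * a                              ∎)
              (≤-trans (m+n≤o⇒n≤o (suc z₀) j<p) (≤-trans p≤r (m≤n+m (suc r) z₀)))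
              (<⇒≤ sum<) (λ sum≡ → contradiction sum≡ (<⇒≢ sum<))
            where
            open ≡-Reasoning
            arrange : ∀ z r j → 1 + r + (z + j) ≡ z + (1 + r) + j
            arrange = solve-∀
            arrange′ : ∀ y q m z r → y + q + m * (z + r) ≡ y + m * z + 1 * (q + m * r)
            arrange′ = solve-∀
          -- Carry: `Z` grows by one and the top row can be reached, but the remainder
          -- `y₀ + suc q - m` is at most `q` because `y₀ < m`.
          ... | inj₂ m≤y with m≤n⇒∃[o]m+o≡n m≤y
          ...   | y , m+y≡ = z₀ + (2 + r) , λ {j} j<p →
            represent 1 (≤-<-trans y≤q q<m) (begin
              y + m * (z₀ + (2 + r))                 ≡⟨ arrange′ y m z₀ r ⟩
              m + y + m * (z₀ + (1 + r))             ≡⟨ cong (_+ m * (z₀ + suc r)) m+y≡ ⟩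
              y₀ + suc q + m * (z₀ + suc r)          ≡⟨ arrange″ y₀ (suc q) m z₀ (suc r) ⟩
              y₀ + m * z₀ + 1 * (suc q + m * suc r)  ≡⟨ cong₂ (λ u v → u + 1 * v) s≡ a≡ ⟨
              s + 1 * a                              ∎)
              (≤-trans (m+n≤o⇒n≤o (suc z₀) j<p) (≤-trans p≤r (≤-trans (n≤1+n _) (m≤n+m (2 + r) z₀))))
              (subst (_≤ suc r + p) (arrange z₀ r j) (+-monoʳ-≤ (suc r) j<p)) (λ _ → y≤q)
            where
            open ≡-Reasoning
            arrange : ∀ z r j → 1 + r + (1 + z + j) ≡ z + (2 + r) + j
            arrange = solve-∀
            arrange′ : ∀ y m z r → y + m * (z + (2 + r)) ≡ m + y + m * (z + (1 + r))
            arrange′ = solve-∀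
            arrange″ : ∀ y q m z r → y + q + m * (z + r) ≡ y + m * z + 1 * (q + m * r)
            arrange″ = solve-∀
            y≤q : y ≤ q
            y≤q = ℕ.s≤s⁻¹ (+-cancelˡ-< m y (suc q) (subst (_< m + suc q) (sym m+y≡) (+-monoˡ-< (suc q) y₀<m)))

          -- The indices `0` to `z₀` use up the ranks of `T = s`; index `suc z₀ + i` continues with
          -- rank `i` of `T = s + a`.
          member : ∀ {j} → j ≤ p →
                   Representation n s z₀ j ⊎
                   ∃ λ i → suc z₀ + i ≡ j × Representation n (s + 1 * a) (proj₁ upper-class) i
          member {j} j≤p with ≤-<-connex j z₀
          ... | inj₁ j≤z₀ = inj₁ (lower-class j≤z₀ j≤p)
          ... | inj₂ z₀<j with i , refl ← m≤n⇒∃[o]m+o≡n z₀<j = inj₂ (i , refl , proj₂ upper-class j≤p)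

          solution : ∀ {j} → j ≤ p → Vec ℕ 3
          solution j≤p with member j≤p
          ... | inj₁ R           = tuple R
          ... | inj₂ (_ , _ , R) = tuple R

          solution-sum : ∀ {j} (j≤p : j ≤ p) → (a ∷ b ∷ c ∷ []) ∙ solution j≤p + a ≡ n
          solution-sum j≤p with member j≤p
          ... | inj₁ R           = trans (cong (λ h → a * x R + (b * y R + h) + a) (+-identityʳ (c * z R))) (sum R)
          ... | inj₂ (_ , _ , R) = trans (cong (λ h → a * x R + (b * y R + h) + a) (+-identityʳ (c * z R))) (sum R)

          -- Within one class the rank is recovered from `z`; across classes `T` differs, as
          -- `s < s + a`.
          solution-injective : ∀ {i j} (i≤p : i ≤ p) (j≤p : j ≤ p) → solution i≤p ≡ solution j≤p → i ≡ j
          solution-injective i≤p j≤p eq with member i≤p | member j≤p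
          ... | inj₁ R              | inj₁ R′              = same-tuple⇒same-rank R R′ eq
          ... | inj₂ (_ , refl , R) | inj₂ (_ , refl , R′) = cong (suc z₀ +_) (same-tuple⇒same-rank R R′ eq)
          ... | inj₁ R              | inj₂ (_ , _ , R′)    =
            contradiction (same-tuple⇒same-class R R′ eq) (<⇒≢ s<s+a)
          ... | inj₂ (_ , _ , R)    | inj₁ R′              =
            contradiction (same-tuple⇒same-class R′ R (sym eq)) (<⇒≢ s<s+a)

    -- At `y = q`, `z = r + p` this compares the two corners: their order is that of `suc q * b` and
    -- `e * a`.
    value-exchange : ∀ y z → value y (suc z) + e * a ≡ value (pred m) z + suc y * b
    value-exchange y z = begin
      b * y + c * suc z + e * a                      ≡⟨ arrange₁ b y c z (e * a) ⟩
      b * y + c * z + (c + e * a)                    ≡⟨ cong (b * y + c * z +_) relation ⟩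
      b * y + c * z + m * b                          ≡⟨ cong (λ h → b * y + c * z + h * b) (suc-pred m) ⟨
      b * y + c * z + (1 + pred m) * b               ≡⟨ arrange₂ b y c z (pred m) ⟩
      b * pred m + c * z + (1 + y) * b               ∎
      where
      open ≡-Reasoning
      arrange₁ : ∀ b y c z h → b * y + c * (1 + z) + h ≡ b * y + c * z + (c + h)
      arrange₁ = solve-∀
      arrange₂ : ∀ b y c z m → b * y + c * z + (1 + m) * b ≡ b * m + c * z + (1 + y) * b
      arrange₂ = solve-∀

    -- By predecessor the solutions for value y₀ z₀ − a have T = T₀ − a < m p, so they are
    -- determined by z, and z < p.
    frobenius : ∀ {q r p y₀ z₀} .{{_ : NonZero b}} .{{_ : NonZero c}} →
                a ≡ suc q + m * suc r → q < m → p ≤ suc r →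
                y₀ < m → y₀ + m * z₀ < a + m * p →
                value q (suc r + p) ≤ value y₀ z₀ → value (pred m) (r + p) ≤ value y₀ z₀ →
                IsFrobenius p (a ∷ b ∷ c ∷ []) (ℤ.+ value y₀ z₀ ℤ.- ℤ.+ a)
    frobenius {q} {r} {p} {y₀} {z₀} a≡ q<m p≤r y₀<m T₀<a+mp G₁≤G G₂≤G =
      isFrobenius-shifted as≢0 few many
      where
      as≢0 : All NonZero (a ∷ b ∷ c ∷ [])
      as≢0 = ℕ.>-nonZero (ℕ.>-nonZero⁻¹ a) ∷ ℕ.>-nonZero (ℕ.>-nonZero⁻¹ b) ∷ ℕ.>-nonZero (ℕ.>-nonZero⁻¹ c) ∷ []

      mp≤a : m * p ≤ a
      mp≤a = ≤-trans (*-monoʳ-≤ m p≤r) (≤-trans (m≤n+m _ (suc q)) (≤-reflexive (sym a≡)))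

      last : Vec ℕ 3 → ℕ
      last (_ ∷ _ ∷ z ∷ []) = z

      class-of : ∀ x y z → (a ∷ b ∷ c ∷ []) ∙ (x ∷ y ∷ z ∷ []) + a ≡ value y₀ z₀ →
                 y + m * z + a ≡ y₀ + m * z₀
      class-of x y z eq = predecessor {p} {y₀} {z₀} mp≤a y₀<m T₀<a+mp {x}
        (trans (cong (λ h → a * x + (b * y + h) + a) (sym (+-identityʳ (c * z)))) eq)

      few : CountBelow p (λ xs → (a ∷ b ∷ c ∷ []) ∙ xs + a ≡ value y₀ z₀)
      few = record
        { key       = last
        ; key<      = λ { {x ∷ y ∷ z ∷ []} eq → *-cancelˡ-< m z p (+-cancelʳ-< a (m * z) (m * p) (begin-strict
            m * z + a        ≤⟨ +-monoˡ-≤ a (m≤n+m (m * z) y) ⟩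
            y + m * z + a    ≡⟨ class-of x y z eq ⟩
            y₀ + m * z₀      <⟨ T₀<a+mp ⟩
            a + m * p        ≡⟨ +-comm a (m * p) ⟩
            m * p + a        ∎)) }
        ; injective = same
        }
        where
        open ≤-Reasoning
        same : ∀ {xs ys} → (a ∷ b ∷ c ∷ []) ∙ xs + a ≡ value y₀ z₀ →
               (a ∷ b ∷ c ∷ []) ∙ ys + a ≡ value y₀ z₀ → last xs ≡ last ys → xs ≡ ys
        same {x ∷ y ∷ z ∷ []} {x′ ∷ y′ ∷ z′ ∷ []} eq eq′ refl
          with refl ← +-cancelʳ-≡ (m * z) y y′ (+-cancelʳ-≡ a _ _
                        (trans (class-of x y z eq) (sym (class-of x′ y′ z eq′))))
          with refl ← *-cancelˡ-≡ x x′ a (+-cancelʳ-≡ _ (a * x) (a * x′) (+-cancelʳ-≡ a _ _ (trans eq (sym eq′))))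
          = refl

      many : ∀ n → value y₀ z₀ < n →
             CountAbove (suc p) (λ xs → (a ∷ b ∷ c ∷ []) ∙ xs + a ≡ n)
      many n G<n with residue a⊥b n
      ... | s , s<a , k , l , n≡ = record
        { element   = λ i → solution-at (bound i)
        ; holds     = λ i → solution-sum a≡ q<m p≤r G₁≤G G₂≤G {n} {s} {k} {l} G<n n≡ y₀<m′ s≡ s<a (bound i)
        ; injective = λ {i} {j} eq → toℕ-injective
            (solution-injective a≡ q<m p≤r G₁≤G G₂≤G {n} {s} {k} {l} G<n n≡ y₀<m′ s≡ s<a (bound i) (bound j) eq)
        }
        where
        -- In this branch the class of `n` takes over: the pair for `solution` is the remainder and
        -- quotient of `s` by `m`, not the outer `y₀` and `z₀`.
        y₀<m′ = m%n<n s m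
        s≡ : s ≡ s % m + m * (s / m)
        s≡ = trans (m≡m%n+[m/n]*n s m) (cong (s % m +_) (*-comm (s / m) m))
        bound : (i : Fin (suc p)) → toℕ i ≤ p
        bound i = ℕ.s≤s⁻¹ (toℕ<n i)
        solution-at : ∀ {j} → j ≤ p → Vec ℕ 3
        solution-at = solution a≡ q<m p≤r G₁≤G G₂≤G {n} {s} {k} {l} G<n n≡ y₀<m′ s≡ s<a

  -- Fibonacci identities behind the assumptions on `a`, `b`, `c`, `m`, `e`.

  F-relation : ∀ k i → F (2 + k + i) + F k * F i ≡ F (2 + k) * F (2 + i)
  F-relation 0 i = trans (+-identityʳ _) (sym (+-identityʳ _))
  F-relation 1 i = arrange (F (suc i)) (F i)
    where
    arrange : ∀ f₁ f₀ → f₁ + f₀ + f₁ + 1 * f₀ ≡ 2 * (f₁ + f₀)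
    arrange = solve-∀
  F-relation (suc (suc k)) i = begin
    F (3 + k + i) + F (2 + k + i) + (F (1 + k) + F k) * F i            ≡⟨ arrange (F (3 + k + i)) (F (2 + k + i)) (F (1 + k)) (F k) (F i) ⟩
    (F (3 + k + i) + F (1 + k) * F i) + (F (2 + k + i) + F k * F i)    ≡⟨ cong₂ _+_ (F-relation (suc k) i) (F-relation k i) ⟩
    F (3 + k) * F (2 + i) + F (2 + k) * F (2 + i)                      ≡⟨ *-distribʳ-+ (F (2 + i)) (F (3 + k)) (F (2 + k)) ⟨
    F (4 + k) * F (2 + i)                                              ∎
    where
    open ≡-Reasoning
    arrange : ∀ u v f₁ f₀ h → u + v + (f₁ + f₀) * h ≡ (u + f₁ * h) + (v + f₀ * h)
    arrange = solve-∀

  -- Both sides obey the Fibonacci recurrence in `k`, so two initial cases suffice. This supplies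
  -- `e * a ≤ c`.
  F*F≤F : ∀ k i → F k * F i ≤ F (2 + k + i)
  F*F≤F 0 i = ℕ.z≤n
  F*F≤F 1 i = ≤-trans (≤-reflexive (+-identityʳ _)) (≤-trans (m≤n+m (F i) (F (suc i))) (m≤m+n _ _))
  F*F≤F (suc (suc k)) i = ≤-trans (≤-reflexive (*-distribʳ-+ (F i) (F (1 + k)) (F k)))
    (+-mono-≤ (F*F≤F (suc k) i) (F*F≤F k i))

  F-coprime-suc : ∀ n → Coprime (F (suc n)) (F n)
  F-coprime-suc 0       = Coprime.1-coprimeTo 0
  F-coprime-suc (suc n) = Coprime.coprime-+ (Coprime.sym (F-coprime-suc n))

  F-coprime : ∀ n → Coprime (F n) (F (2 + n))
  F-coprime n = Coprime.sym (subst (λ h → Coprime h (F n)) (+-comm (F n) (F (suc n)))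
    (Coprime.coprime-+ (F-coprime-suc n)))

open Arithmetic
open import Data.Integer.Base using (+_; _+_; _-_; _*_; _≥_; _<_; 1ℤ)

-- The Fibonacci triple with positive quotient, written `suc r`.

module _ {i k p r q : ℕ} (3≤i : 3 ≤ i) (3≤k : 3 ≤ k)
  (a≡ : F i ≡ suc q ℕ.+ F k ℕ.* suc r) (q<m : q ℕ.< F k) (p≤r : p ≤ suc r) where

  private
    a b c m e : ℕ
    a = F i
    b = F (i ℕ.+ 2)
    c = F (i ℕ.+ k)
    m = F k
    e = F (k ∸ 2)

    instance
      a≢0 : NonZero a
      a≢0 = F-nonZero 3≤i
      b≢0 : NonZero b
      b≢0 = F-nonZero (≤-trans 3≤i (m≤m+n i 2))
      c≢0 : NonZero c
      c≢0 = F-nonZero (≤-trans 3≤i (m≤m+n i k))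
      m≢0 : NonZero m
      m≢0 = F-nonZero 3≤k

    k≡ : 2 ℕ.+ (k ∸ 2) ≡ k
    k≡ = m+[n∸m]≡n (≤-trans (n≤1+n 2) 3≤k)

    c≡ : F (2 ℕ.+ (k ∸ 2) ℕ.+ i) ≡ c
    c≡ = cong F (trans (cong (ℕ._+ i) k≡) (+-comm k i))

    b≡ : F (2 ℕ.+ i) ≡ b
    b≡ = cong F (+-comm 2 i)

    relation : c ℕ.+ e ℕ.* a ≡ m ℕ.* b
    relation = trans (cong (ℕ._+ e ℕ.* a) (sym c≡))
      (trans (F-relation (k ∸ 2) i) (cong₂ ℕ._*_ (cong F k≡) b≡))

    m*[1+r]≤a : m ℕ.* suc r ≤ a
    m*[1+r]≤a = ≤-trans (m≤n+m _ (suc q)) (≤-reflexive (sym a≡))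

    mr+mp≤a+mp : m ℕ.* (suc r ℕ.+ p) ≤ a ℕ.+ m ℕ.* p
    mr+mp≤a+mp = ≤-trans (≤-reflexive (*-distribˡ-+ m (suc r) p)) (+-monoˡ-≤ (m ℕ.* p) m*[1+r]≤a)

  open Triple {a} {b} {c} {m} {e} (subst (Coprime a) b≡ (F-coprime i)) relation
    (≤-trans (F*F≤F (k ∸ 2) i) (≤-reflexive c≡))
    (≤-trans (m≤m*n m (suc r)) m*[1+r]≤a)

  private
    G₁ G₂ : ℕ
    G₁ = value q (suc r ℕ.+ p)
    G₂ = value (pred m) (r ℕ.+ p)

    frobenius₁ : e ℕ.* a ≤ suc q ℕ.* b → IsFrobenius p (a ∷ b ∷ c ∷ []) (+ G₁ - + a)
    -- The bound on `T₀` is tight here: `q + m * (suc r + p)` is one less than `a + m * p`.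
    frobenius₁ ea≤[1+q]b = frobenius a≡ q<m p≤r q<m (≤-reflexive (begin
        suc q ℕ.+ m ℕ.* (suc r ℕ.+ p)             ≡⟨ cong (suc q ℕ.+_) (*-distribˡ-+ m (suc r) p) ⟩
        suc q ℕ.+ (m ℕ.* suc r ℕ.+ m ℕ.* p)       ≡⟨ +-assoc (suc q) _ _ ⟨
        suc q ℕ.+ m ℕ.* suc r ℕ.+ m ℕ.* p         ≡⟨ cong (ℕ._+ m ℕ.* p) a≡ ⟨
        a ℕ.+ m ℕ.* p                                 ∎))
      ≤-refl
      (+-cancelʳ-≤ (e ℕ.* a) G₂ G₁
        (≤-trans (+-monoʳ-≤ G₂ ea≤[1+q]b) (≤-reflexive (sym (value-exchange q (r ℕ.+ p))))))
      where open ≡-Reasoning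

    frobenius₂ : suc q ℕ.* b ≤ e ℕ.* a → IsFrobenius p (a ∷ b ∷ c ∷ []) (+ G₂ - + a)
    frobenius₂ [1+q]b≤ea = frobenius a≡ q<m p≤r (≤-reflexive (suc-pred m))
      (≤-trans (≤-reflexive (trans (cong (ℕ._+ m ℕ.* (r ℕ.+ p)) (suc-pred m)) (sym (*-suc m (r ℕ.+ p))))) mr+mp≤a+mp)
      (+-cancelʳ-≤ (e ℕ.* a) G₁ G₂
        (≤-trans (≤-reflexive (value-exchange q (r ℕ.+ p))) (+-monoʳ-≤ G₂ [1+q]b≤ea)))
      ≤-refl

    1+q≡ : + a - + suc r * + m ≡ + suc q
    1+q≡ = begin
      + a - + suc r * + m                                    ≡⟨ cong (λ h → + h - + suc r * + m) a≡ ⟩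
      + suc q + + (m ℕ.* suc r) - + suc r * + m          ≡⟨ cong (λ h → + suc q + h - + suc r * + m) (ℤ.pos-* m (suc r)) ⟩
      + suc q + + m * + suc r - + suc r * + m            ≡⟨ arrange (+ suc q) (+ m) (+ suc r) ⟩
      + suc q                                                ∎
      where
      open ≡-Reasoning
      arrange : ∀ q m r → q + m * r - r * m ≡ q
      arrange = ℤ.solve-∀

    +-value : ∀ y z → + value y z ≡ + y * + b + + z * + c
    +-value y z = cong₂ _+_ (trans (cong +_ (*-comm b y)) (ℤ.pos-* y b)) (trans (cong +_ (*-comm c z)) (ℤ.pos-* z c))

    pred≡ : + m - 1ℤ ≡ + pred m
    pred≡ = cong (λ h → + h - 1ℤ) (sym (suc-pred m))

  isFrobenius-positive-quotient :
    ((+ a - + suc r * + m) * + b ≥ + e * + a →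
      IsFrobenius p (a ∷ b ∷ c ∷ [])
        ((+ a - + suc r * + m - 1ℤ) * + b + (+ suc r + + p) * + c - + a))
    ×
    ((+ a - + suc r * + m) * + b < + e * + a →
      IsFrobenius p (a ∷ b ∷ c ∷ [])
        ((+ m - 1ℤ) * + b + (+ suc r + + p - 1ℤ) * + c - + a))
  -- The rewrites turn both sides of the case condition into images of naturals, so the order can be
  -- read off in the naturals.
  isFrobenius-positive-quotient rewrite 1+q≡ | pred≡ | sym (ℤ.pos-* (suc q) b) | sym (ℤ.pos-* e a) =
    (λ h → subst (λ g → IsFrobenius p (a ∷ b ∷ c ∷ []) (g - + a)) (+-value q (suc r ℕ.+ p))
             (frobenius₁ (ℤ.drop‿+≤+ h))) ,
    (λ h → subst (λ g → IsFrobenius p (a ∷ b ∷ c ∷ []) (g - + a)) (+-value (pred m) (r ℕ.+ p))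
             (frobenius₂ (<⇒≤ (ℤ.drop‿+<+ h))))

theorem5 :
    ∀ (i k p : ℕ) → 3 ≤ i → (3≤k : 3 ≤ k) →
    let r    = _/_ (F i ∸ 1) (F k) {{F-nonZero 3≤k}}
        as   = F i ∷ F (i ℕ.+ 2) ∷ F (i ℕ.+ k) ∷ []
        Fᵢ   = + F i
        Fₖ   = + F k
        Fₖ₋₂ = + F (k ∸ 2)
        Fᵢ₊₂ = + F (i ℕ.+ 2)
        Fᵢ₊ₖ = + F (i ℕ.+ k)
    in
    p ≤ r → (r , p) ≢ (0 , 0) →
    ((Fᵢ - + r * Fₖ) * Fᵢ₊₂ ≥ Fₖ₋₂ * Fᵢ →
      IsFrobenius p as
        ((Fᵢ - + r * Fₖ - 1ℤ) * Fᵢ₊₂ + (+ r + + p) * Fᵢ₊ₖ - Fᵢ))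
    ×
    ((Fᵢ - + r * Fₖ) * Fᵢ₊₂ < Fₖ₋₂ * Fᵢ →
      IsFrobenius p as
        ((Fₖ - 1ℤ) * Fᵢ₊₂ + (+ r + + p - 1ℤ) * Fᵢ₊ₖ - Fᵢ))
theorem5 i k p 3≤i 3≤k p≤r r,p≢0,0
  with _/_ (F i ∸ 1) (F k) {{F-nonZero 3≤k}} in r≡
-- A zero quotient forces `p = 0`, the excluded pair.
... | 0     with refl ← n≤0⇒n≡0 p≤r = contradiction refl r,p≢0,0
... | suc r = isFrobenius-positive-quotient 3≤i 3≤k a≡ (m%n<n (F i ∸ 1) (F k)) p≤r
  where
  open ≡-Reasoning
  instance
    a≢0 : NonZero (F i)
    a≢0 = F-nonZero 3≤i
    m≢0 : NonZero (F k)
    m≢0 = F-nonZero 3≤k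
  -- Dividing `F i - 1` rather than `F i` puts the remaining part `suc q` of `F i` between `1` and
  -- `F k`.
  q : ℕ
  q = (F i ∸ 1) % F k
  a≡ : F i ≡ suc q ℕ.+ F k ℕ.* suc r
  a≡ = begin
    F i                                         ≡⟨ m+[n∸m]≡n (ℕ.>-nonZero⁻¹ (F i)) ⟨
    suc (F i ∸ 1)                               ≡⟨ cong suc (m≡m%n+[m/n]*n (F i ∸ 1) (F k)) ⟩
    suc (q ℕ.+ (F i ∸ 1) / F k ℕ.* F k)         ≡⟨ cong (λ h → suc (q ℕ.+ h ℕ.* F k)) r≡ ⟩
    suc (q ℕ.+ suc r ℕ.* F k)                   ≡⟨ cong (suc q ℕ.+_) (*-comm (suc r) (F k)) ⟩
    suc q ℕ.+ F k ℕ.* suc r                     ∎
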